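{- There is a finite set $\mathcal{F}$ of graphs such that $\textsc{QPoly}\le_p\textsc{HomRec}(\mathcal{F})$.
   Context: $\hom(F,G)$ is the number of homomorphisms from graph $F$ to graph $G$. $\textsc{HomRec}(\mathcal{F})$: given pairs $(F_1,h_1),\dots,(F_m,h_m)\in\mathcal{F}\times\mathbb{N}$ (numbers in binary), decide whether there is a graph $G$ with $\hom(F_i,G)=h_i$ for all $i$. $\textsc{QPoly}$: given natural numbers $a,b,c$ in binary, decide whether there are $x,y\in\mathbb{N}$ with $ax^2+by=c$. $\le_p$ denotes polynomial-time many-one reducibility. -}

module Defs where

open import Data.Nat using (ℕ; zero; suc; _+_; _*_; _^_)
open import Data.Nat.DivMod using (_/_; _%_)
open import Data.Bool using (Bool; true; false; _∧_; if_then_else_)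
open import Data.Fin using (Fin; zero; suc; toℕ)
open import Data.List using (List; []; _∷_; _++_; length; map; concatMap; allFin; reverse; filter; lookup)
open import Data.List.Relation.Unary.All using (All)
open import Data.Vec using (Vec; []; _∷_)
open import Data.Maybe using (Maybe; just; nothing)
open import Data.Product using (Σ; _×_; _,_)
open import Relation.Binary.PropositionalEquality using (_≡_)
open import Relation.Nullary using (Dec; yes; no)
open import Data.Bool.Properties using () renaming (_≟_ to _≟B_)

record Graph : Set where
  field
    n     : ℕ
    adj   : Fin n → Fin n → Bool
    sym   : ∀ u v → adj u v ≡ adj v u
    irrefl : ∀ u → adj u u ≡ false
open Graph public

allMaps : (k m : ℕ) → List (Vec (Fin m) k)
allMaps zero    m = [] ∷ []
allMaps (suc k) m = concatMap (λ v → map (λ x → x ∷ v) (allFin m)) (allMaps k m)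

vlookup : ∀ {A : Set} {k} → Vec A k → Fin k → A
vlookup (x ∷ xs) zero    = x
vlookup (x ∷ xs) (suc i) = vlookup xs i

andAll : List Bool → Bool
andAll []       = true
andAll (b ∷ bs) = b ∧ andAll bs

implies : Bool → Bool → Bool
implies true  b = b
implies false _ = true

isHom : (F G : Graph) → Vec (Fin (n G)) (n F) → Bool
isHom F G f =
  andAll (concatMap (λ u → map (λ v →
      implies (adj F u v) (adj G (vlookup f u) (vlookup f v)))
    (allFin (n F))) (allFin (n F)))

hom : Graph → Graph → ℕ
hom F G = length (filter (λ f → isHom F G f ≟B true) (allMaps (n F) (n G)))

data Sym : Set where
  b0 b1 sep : Sym

Word : Set
Word = List Sym

Lang : Set₁
Lang = Word → Set

-- least significant bit first, fuel-bounded
binAux : ℕ → ℕ → Word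
binAux zero    _       = []
binAux (suc f) zero    = []
binAux (suc f) (suc m) =
  (if (suc m % 2) Data.Nat.≡ᵇ 0 then b0 else b1) ∷ binAux f (suc m / 2)

-- canonical binary representation (most significant bit first, no
-- leading zeros; 0 is written as "0")
bin : ℕ → Word
bin zero    = b0 ∷ []
bin (suc m) = reverse (binAux (suc m) (suc m))

QPoly : Lang
QPoly w = Σ ℕ λ a → Σ ℕ λ b → Σ ℕ λ c →
  (w ≡ bin a ++ sep ∷ bin b ++ sep ∷ bin c) ×
  Σ ℕ λ x → Σ ℕ λ y → a * (x * x) + b * y ≡ c

encPairs : ∀ {k} → List (Fin k × ℕ) → Word
encPairs []              = []
encPairs ((i , h) ∷ ps) = bin (toℕ i) ++ sep ∷ bin h ++ sep ∷ encPairs ps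

HomRec : List Graph → Lang
HomRec 𝓕 w = Σ (List (Fin (length 𝓕) × ℕ)) λ ps →
  (w ≡ encPairs ps) ×
  Σ Graph λ G → All (λ p → hom (lookup 𝓕 (Data.Product.proj₁ p)) G ≡ Data.Product.proj₂ p) ps

-- Deterministic single-tape Turing machines (two-way infinite tape).
-- Tape alphabet Fin (4 + γ): 0 = blank, 1,2,3 = the input symbols 0,1,#,
-- the rest are extra work symbols.

data Move : Set where
  L R S : Move

record TM : Set where
  field
    q γ : ℕ
    -- states Fin (suc q), start state zero; δ = nothing means halt
    δ : Fin (suc q) → Fin (4 + γ) → Maybe (Fin (suc q) × Fin (4 + γ) × Move)

module _ (M : TM) where
  open TM M

  Tape : Set
  Tape = Fin (4 + γ)

  blank : Tape
  blank = zero

  enc : Sym → Tape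
  enc b0  = suc zero
  enc b1  = suc (suc zero)
  enc sep = suc (suc (suc zero))

  dec : Tape → Maybe Sym
  dec (suc zero)             = just b0
  dec (suc (suc zero))       = just b1
  dec (suc (suc (suc zero))) = just sep
  dec _                      = nothing

  record Config : Set where
    constructor cfg
    field
      state : Fin (suc q)
      left  : List Tape   -- cells left of the head, nearest first
      head  : Tape
      right : List Tape   -- cells right of the head, nearest first

  initial : Word → Config
  initial []       = cfg zero [] blank []
  initial (s ∷ ws) = cfg zero [] (enc s) (map enc ws)

  move : Move → Fin (suc q) → List Tape → Tape → List Tape → Config
  move S st l h r             = cfg st l h r
  move L st []      h r       = cfg st [] blank (h ∷ r)
  move L st (x ∷ l) h r       = cfg st l x (h ∷ r)
  move R st l       h []      = cfg st (h ∷ l) blank []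
  move R st l       h (x ∷ r) = cfg st (h ∷ l) x r

  run : ℕ → Config → Maybe Config
  run t (cfg st l h r) with δ st h
  ... | nothing = just (cfg st l h r)
  run zero    _              | just _ = nothing
  run (suc t) (cfg st l h r) | just (st' , h' , m) = run t (move m st' l h' r)

  readOut : List Tape → Word
  readOut []       = []
  readOut (x ∷ xs) with dec x
  ... | just s  = s ∷ readOut xs
  ... | nothing = []

  output : Config → Word
  output (cfg _ _ h r) = readOut (h ∷ r)

  HaltsWith : Word → ℕ → Word → Set
  HaltsWith w t o = Σ Config λ c → (run t (initial w) ≡ just c) × (output c ≡ o)

_≤p_ : Lang → Lang → Set
A ≤p B = Σ TM λ M → Σ ℕ λ c → Σ ℕ λ d →
  ∀ (w : Word) → Σ Word λ o →
    HaltsWith M w (c * suc (length w) ^ d) o ×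
    ((A w → B o) × (B o → A w))

{-# OPTIONS --safe #-}

-- A graph C with exactly one homomorphism to G provides G with named vertices.
-- Extending C by a vertex joined to prescribed vertices of C counts common
-- neighbours in G of the images of these vertices. With t₁ and t₂ being the
-- only common neighbours of the images of T, the extension Fᶜ of C counts
--   Σ_{t ∈ {t₁, t₂}} |N(t, Γ)| · |N(t, Δ)| · |N(t, B)|²,
-- where N(t, X) is the set of common neighbours of t and X. Since C contains
-- the only elements of N(t₁, Δ) and N(t₂, B), fixing |N(t₁, Γ)| = a and
-- |N(t₂, Γ)| = b turns the sum into a x² + b y, with x = |N(t₁, B)| and
-- y = |N(t₂, Δ)| free. As a, b and c occur literally among the prescribed
-- numbers, the reduction only has to check the input and insert fixed symbols.

module Submission where

open import Defs
open import Data.Bool using (Bool; true; false; _∧_; if_then_else_)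
open import Data.Bool.Properties using (∧-conicalˡ; ∧-conicalʳ) renaming (_≟_ to _≟B_)
open import Data.Fin using (Fin; zero; suc; #_; toℕ; fromℕ; inject₁; _↑ʳ_; combine; remQuot; splitAt; join)
import Data.Fin.Properties as Fin
open import Data.List using (List; []; _∷_; _++_; length; map; concatMap; allFin; filter; lookup;
  replicate; tabulate; foldl; reverse; head; drop)
open import Data.List.Membership.Propositional using (_∈_)
open import Data.List.Membership.Propositional.Properties
open import Data.List.Properties hiding (sum-++)
open import Data.List.Relation.Binary.Permutation.Propositional using (↭-sym)
open import Data.List.Relation.Binary.Permutation.Propositional.Properties using (All-resp-↭; ↭-reverse)
open import Data.List.Relation.Unary.All as All using (All; []; _∷_)
import Data.List.Relation.Unary.All.Properties as All
open import Data.List.Relation.Unary.Any as Any using (here; there)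
open import Data.Maybe as Maybe using (Maybe; just; nothing)
open import Data.Maybe.Properties using (just-injective)
open import Data.Nat using (ℕ; zero; suc; _+_; _*_; _^_; _≤_; _<_; _≡ᵇ_; z≤n; s≤s; >-nonZero)
open import Data.Nat.DivMod using (_/_; _%_; m/n<m; m/n≡0⇒m<n; m%n<n; m≡m%n+[m/n]*n;
  m*n%n≡0; m*n/n≡m; [m+kn]%n≡m%n; +-distrib-/)
open import Data.Nat.ListAction using (sum)
open import Data.Nat.ListAction.Properties using (sum-++)
open import Data.Nat.Properties
open import Data.Nat.Solver using (module +-*-Solver)
open import Data.Product as Product using (Σ; ∃-syntax; _×_; _,_; proj₁; proj₂)
open import Data.Sum as Sum using (_⊎_; inj₁; inj₂)
open import Data.Vec as Vec using (Vec; []; _∷_)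
import Data.Vec.Properties as Vec
open import Function using (_∘_; id)
open import Relation.Binary.PropositionalEquality as ≡
  using (_≡_; _≢_; refl; trans; cong; cong₂; subst; subst₂; module ≡-Reasoning)
open import Relation.Nullary using (Dec; does; yes; contradiction)
open import Relation.Nullary.Decidable using (dec-true)

-- Homomorphisms and extensions by one vertex

Preserves : (F G : Graph) → Vec (Fin (n G)) (n F) → Set
Preserves F G f = ∀ u v → adj F u v ≡ true → adj G (vlookup f u) (vlookup f v) ≡ true

≡true-ext : ∀ {a b} → (a ≡ true → b ≡ true) → (b ≡ true → a ≡ true) → a ≡ b
≡true-ext {false} {false} _ _ = refl
≡true-ext {false} {true}  _ g = g refl
≡true-ext {true}  {false} f _ = ≡.sym (f refl)
≡true-ext {true}  {true}  _ _ = refl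

implies-intro : ∀ {a b} → (a ≡ true → b ≡ true) → implies a b ≡ true
implies-intro {true}  f = f refl
implies-intro {false} f = refl

implies-elim : ∀ {a b} → implies a b ≡ true → a ≡ true → b ≡ true
implies-elim p refl = p

andAll-intro : ∀ {bs} → All (_≡ true) bs → andAll bs ≡ true
andAll-intro []          = refl
andAll-intro (refl ∷ ps) = andAll-intro ps

andAll-elim : ∀ bs → andAll bs ≡ true → All (_≡ true) bs
andAll-elim []          p = []
andAll-elim (true ∷ bs) p = refl ∷ andAll-elim bs p

isHom-intro : ∀ F G f → Preserves F G f → isHom F G f ≡ true
isHom-intro F G f p = andAll-intro (All.concat⁺ (All.map⁺ (All.tabulate⁺ λ u →
  All.map⁺ (All.tabulate⁺ λ v → implies-intro (p u v)))))

isHom-elim : ∀ F G f → isHom F G f ≡ true → Preserves F G f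
isHom-elim F G f p u v = implies-elim (All.lookup (andAll-elim _ p)
  (∈-concatMap⁺ _ (Any.map (λ { refl → ∈-map⁺ _ (∈-allFin v) }) (∈-allFin u))))

-- Graphs are built one vertex at a time. Indices are de Bruijn: in s ▷ N the
-- new vertex is zero, its neighbours are the vertices suc i with i ∈ N.
data Build : ℕ → Set where
  ε   : Build 0
  _▷_ : ∀ {k} → Build k → List (Fin k) → Build (suc k)

infixl 4 _▷_

_∈?_ : ∀ {k} (i : Fin k) N → Dec (i ∈ N)
i ∈? N = Any.any? (i Fin.≟_) N

badj : ∀ {k} → Build k → Fin k → Fin k → Bool
badj (s ▷ N) zero    zero    = false
badj (s ▷ N) zero    (suc j) = does (j ∈? N)
badj (s ▷ N) (suc i) zero    = does (i ∈? N)
badj (s ▷ N) (suc i) (suc j) = badj s i j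

badj-sym : ∀ {k} (s : Build k) u v → badj s u v ≡ badj s v u
badj-sym (s ▷ N) zero    zero    = refl
badj-sym (s ▷ N) zero    (suc j) = refl
badj-sym (s ▷ N) (suc i) zero    = refl
badj-sym (s ▷ N) (suc i) (suc j) = badj-sym s i j

badj-irrefl : ∀ {k} (s : Build k) u → badj s u u ≡ false
badj-irrefl (s ▷ N) zero    = refl
badj-irrefl (s ▷ N) (suc i) = badj-irrefl s i

⟦_⟧ : ∀ {k} → Build k → Graph
⟦_⟧ {k} s = record { n = k ; adj = badj s ; sym = badj-sym s ; irrefl = badj-irrefl s }

joined : ∀ {m} → (Fin m → Fin m → Bool) → List (Fin m) → Fin m → Bool
joined a zs x = andAll (map (a x) zs)

nbrs : (G : Graph) → List (Fin (n G)) → List (Fin (n G))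
nbrs G zs = filter (λ x → joined (adj G) zs x ≟B true) (allFin (n G))

-- Choosing images one vertex at a time turns a count of homomorphisms into an iterated sum over
-- common neighbours; `homs-filter` identifies this list with the one whose length `hom` takes.
homs : ∀ {k} → Build k → (G : Graph) → List (Vec (Fin (n G)) k)
homs ε       G = [] ∷ []
homs (s ▷ N) G = concatMap (λ f → map (_∷ f) (nbrs G (map (vlookup f) N))) (homs s G)

joined-elim : ∀ {m} (a : Fin m → Fin m → Bool) zs x → joined a zs x ≡ true →
              ∀ {z} → z ∈ zs → a x z ≡ true
joined-elim a zs x p z∈ = All.lookup (andAll-elim _ p) (∈-map⁺ (a x) z∈)

does-true : ∀ {P : Set} (P? : Dec P) → does P? ≡ true → P
does-true (yes p) _ = p

-- An edge of `s ▷ N` lies in `s` or joins the new vertex to `N`. The latter edges are met in both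
-- directions, and the symmetry of `G` settles the second.
isHom-▷ : ∀ {k} (s : Build k) N G x f →
          isHom ⟦ s ▷ N ⟧ G (x ∷ f) ≡ isHom ⟦ s ⟧ G f ∧ joined (adj G) (map (vlookup f) N) x
isHom-▷ s N G x f = ≡true-ext to from
  where
  to : isHom ⟦ s ▷ N ⟧ G (x ∷ f) ≡ true →
       isHom ⟦ s ⟧ G f ∧ joined (adj G) (map (vlookup f) N) x ≡ true
  to p = cong₂ _∧_
    (isHom-intro ⟦ s ⟧ G f λ u v → h (suc u) (suc v))
    (andAll-intro (All.map⁺ {f = adj G x} (All.map⁺ {f = vlookup f} (All.tabulate λ {j} j∈ →
      h zero (suc j) (dec-true (j ∈? N) j∈)))))
    where h = isHom-elim ⟦ s ▷ N ⟧ G (x ∷ f) p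

  from : isHom ⟦ s ⟧ G f ∧ joined (adj G) (map (vlookup f) N) x ≡ true →
         isHom ⟦ s ▷ N ⟧ G (x ∷ f) ≡ true
  from p = isHom-intro ⟦ s ▷ N ⟧ G (x ∷ f) λ where
      zero    (suc j) q → new j (does-true (j ∈? N) q)
      (suc i) zero    q → trans (Graph.sym G _ _) (new i (does-true (i ∈? N) q))
      (suc i) (suc j) q → isHom-elim ⟦ s ⟧ G f (∧-conicalˡ _ _ p) i j q
    where
    new : ∀ j → j ∈ N → adj G x (vlookup f j) ≡ true
    new j j∈ = joined-elim (adj G) _ x (∧-conicalʳ (isHom ⟦ s ⟧ G f) _ p) (∈-map⁺ (vlookup f) j∈)

-- The inductive step of `homs-filter` with the graphs abstracted away: a test that splits as a
-- conjunction can be made on the tail before the new entry is chosen.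
filter-∧-concatMap : ∀ {A : Set} {k} (p : Vec A (suc k) → Bool) (p′ : Vec A k → Bool)
  (q : Vec A k → A → Bool) (X : List A) → (∀ x f → p (x ∷ f) ≡ p′ f ∧ q f x) → ∀ fs →
  filter (λ g → p g ≟B true) (concatMap (λ f → map (_∷ f) X) fs) ≡
  concatMap (λ f → map (_∷ f) (filter (λ x → q f x ≟B true) X)) (filter (λ f → p′ f ≟B true) fs)
filter-∧-concatMap p p′ q X split []       = refl
filter-∧-concatMap p p′ q X split (f ∷ fs) =
  trans (filter-++ _ (map (_∷ f) X) _)
    (trans (cong (filter (λ g → p g ≟B true) (map (_∷ f) X) ++_) (filter-∧-concatMap p p′ q X split fs))
           first)
  where
  rest = concatMap (λ f → map (_∷ f) (filter (λ x → q f x ≟B true) X)) (filter (λ f → p′ f ≟B true) fs)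

  accept : p′ f ≡ true → ∀ Y → filter (λ g → p g ≟B true) (map (_∷ f) Y) ≡
                               map (_∷ f) (filter (λ x → q f x ≟B true) Y)
  accept e []      = refl
  accept e (y ∷ Y) with p (y ∷ f) | trans (split y f) (cong (_∧ q f y) e)
  ... | _ | refl with q f y
  ...   | true  = cong (_ ∷_) (accept e Y)
  ...   | false = accept e Y

  reject : p′ f ≡ false → ∀ Y → filter (λ g → p g ≟B true) (map (_∷ f) Y) ≡ []
  reject e []      = refl
  reject e (y ∷ Y) with p (y ∷ f) | trans (split y f) (cong (_∧ q f y) e)
  ... | _ | refl = reject e Y

  first : filter (λ g → p g ≟B true) (map (_∷ f) X) ++ rest ≡
          concatMap (λ f → map (_∷ f) (filter (λ x → q f x ≟B true) X))
                    (filter (λ f → p′ f ≟B true) (f ∷ fs))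
  first with p′ f in e
  ... | true  = cong (_++ rest) (accept e X)
  ... | false = cong (_++ rest) (reject e X)

homs-filter : ∀ {k} (s : Build k) G →
              filter (λ f → isHom ⟦ s ⟧ G f ≟B true) (allMaps k (n G)) ≡ homs s G
homs-filter ε       G = refl
homs-filter (s ▷ N) G = trans
  (filter-∧-concatMap (isHom ⟦ s ▷ N ⟧ G) (isHom ⟦ s ⟧ G) (λ f → joined (adj G) (map (vlookup f) N))
    (allFin (n G)) (isHom-▷ s N G) (allMaps _ (n G)))
  (cong (concatMap _) (homs-filter s G))

homs-preserve : ∀ {k} (s : Build k) G {f} → f ∈ homs s G → Preserves ⟦ s ⟧ G f
homs-preserve s G {f} f∈ = isHom-elim ⟦ s ⟧ G f (proj₂ (∈-filter⁻ (λ f → isHom ⟦ s ⟧ G f ≟B true)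
  {xs = allMaps _ (n G)} (subst (f ∈_) (≡.sym (homs-filter s G)) f∈)))

-- Weighted counting

∑ : ∀ {A : Set} → List A → (A → ℕ) → ℕ
∑ xs w = sum (map w xs)

∑-cong : ∀ {A : Set} (xs : List A) {v w : A → ℕ} → (∀ x → v x ≡ w x) → ∑ xs v ≡ ∑ xs w
∑-cong xs e = cong sum (map-cong e xs)

∑-concatMap : ∀ {A B : Set} (g : A → List B) (xs : List A) (w : B → ℕ) →
              ∑ (concatMap g xs) w ≡ ∑ xs (λ x → ∑ (g x) w)
∑-concatMap g []       w = refl
∑-concatMap g (x ∷ xs) w = begin
  sum (map w (g x ++ concatMap g xs))         ≡⟨ cong sum (map-++ w (g x) _) ⟩
  sum (map w (g x) ++ map w (concatMap g xs)) ≡⟨ sum-++ (map w (g x)) _ ⟩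
  ∑ (g x) w + ∑ (concatMap g xs) w            ≡⟨ cong (∑ (g x) w +_) (∑-concatMap g xs w) ⟩
  ∑ (g x) w + ∑ xs (λ x → ∑ (g x) w)          ∎
  where open ≡-Reasoning

∑-map : ∀ {A B : Set} (g : A → B) (xs : List A) (w : B → ℕ) → ∑ (map g xs) w ≡ ∑ xs (w ∘ g)
∑-map g xs w = cong sum (≡.sym (map-∘ xs))

∑-const : ∀ {A : Set} (xs : List A) c → ∑ xs (λ _ → c) ≡ length xs * c
∑-const []       c = refl
∑-const (x ∷ xs) c = cong (c +_) (∑-const xs c)

∑-*ˡ : ∀ {A : Set} (xs : List A) c (w : A → ℕ) → ∑ xs (λ x → c * w x) ≡ c * ∑ xs w
∑-*ˡ []       c w = ≡.sym (*-zeroʳ c)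
∑-*ˡ (x ∷ xs) c w = trans (cong (c * w x +_) (∑-*ˡ xs c w)) (≡.sym (*-distribˡ-+ c (w x) _))

∑-▷ : ∀ {k} (s : Build k) N G w →
      ∑ (homs (s ▷ N) G) w ≡
      ∑ (homs s G) (λ f → ∑ (nbrs G (map (vlookup f) N)) (λ x → w (x ∷ f)))
∑-▷ s N G w = trans (∑-concatMap _ (homs s G) w)
  (∑-cong (homs s G) λ f → ∑-map (_∷ f) (nbrs G (map (vlookup f) N)) w)

hom≡∑ : ∀ {k} (s : Build k) G → hom ⟦ s ⟧ G ≡ ∑ (homs s G) (λ _ → 1)
hom≡∑ s G = trans (cong length (homs-filter s G))
  (≡.sym (trans (∑-const (homs s G) 1) (*-identityʳ _)))

-- Blow-ups

-- Positions in `X` are the vertices, so equal entries give twins, which `irrefl` keeps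
-- non-adjacent, and vertices missing from `X` disappear.
pullback : (G : Graph) → List (Fin (n G)) → Graph
pullback G X = record
  { n      = length X
  ; adj    = λ u v → adj G (lookup X u) (lookup X v)
  ; sym    = λ u v → Graph.sym G (lookup X u) (lookup X v)
  ; irrefl = λ u → irrefl G (lookup X u)
  }

copies : ∀ {k} → (Fin k → ℕ) → List (Fin k)
copies m = concatMap (λ i → replicate (m i) i) (allFin _)

blowup : (G : Graph) → (Fin (n G) → ℕ) → Graph
blowup G m = pullback G (copies m)

∏ : ∀ {A : Set} {k} → (A → ℕ) → Vec A k → ℕ
∏ m []      = 1
∏ m (x ∷ f) = m x * ∏ m f

∑-allFin-lookup : ∀ {A : Set} (X : List A) w → ∑ (allFin (length X)) (w ∘ lookup X) ≡ ∑ X w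
∑-allFin-lookup X w = cong sum (trans (map-tabulate id (w ∘ lookup X))
  (trans (≡.sym (map-tabulate (lookup X) w)) (cong (map w) (tabulate-lookup X))))

∑-replicate : ∀ {A : Set} k (x : A) (w : A → ℕ) → ∑ (replicate k x) w ≡ k * w x
∑-replicate zero    x w = refl
∑-replicate (suc k) x w = cong (w x +_) (∑-replicate k x w)

∑-copies : ∀ {k} (m w : Fin k → ℕ) → ∑ (copies m) w ≡ ∑ (allFin k) (λ i → m i * w i)
∑-copies m w = trans (∑-concatMap (λ i → replicate (m i) i) (allFin _) w)
  (∑-cong (allFin _) λ i → ∑-replicate (m i) i w)

∑-filter : ∀ {A : Set} (p : A → Bool) xs w →
           ∑ (filter (λ x → p x ≟B true) xs) w ≡ ∑ xs (λ x → if p x then w x else 0)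
∑-filter p []       w = refl
∑-filter p (x ∷ xs) w with p x
... | true  = cong (w x +_) (∑-filter p xs w)
... | false = ∑-filter p xs w

vlookup-map : ∀ {A B : Set} (g : A → B) {k} (f : Vec A k) i → vlookup (Vec.map g f) i ≡ g (vlookup f i)
vlookup-map g (x ∷ f) zero    = refl
vlookup-map g (x ∷ f) (suc i) = vlookup-map g f i

-- A homomorphism to the blow-up is a homomorphism to `G` with a choice of copy for each vertex. The
-- weight `w` makes the induction go through: the sum over the new vertex is absorbed into the
-- weight `w′` for `s`.
∑-homs-blowup : ∀ {k} (s : Build k) G m w →
  ∑ (homs s (blowup G m)) (λ f → w (Vec.map (lookup (copies m)) f)) ≡
  ∑ (homs s G) (λ f → ∏ m f * w f)
∑-homs-blowup ε       G m w = cong (_+ 0) (≡.sym (*-identityˡ (w [])))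
∑-homs-blowup (s ▷ N) G m w = begin
  ∑ (homs (s ▷ N) B) (λ f → w (Vec.map κ f))
    ≡⟨ ∑-▷ s N B _ ⟩
  ∑ (homs s B) (λ f → ∑ (nbrs B (map (vlookup f) N)) (λ x → w (κ x ∷ Vec.map κ f)))
    -- Adjacency in `B` depends only on the projections to `G`, so the inner sum is a function of
    -- `Vec.map κ f`.
    ≡⟨ ∑-cong (homs s B) step ⟩
  ∑ (homs s B) (λ f → w′ (Vec.map κ f))
    ≡⟨ ∑-homs-blowup s G m w′ ⟩
  ∑ (homs s G) (λ f → ∏ m f * w′ f)
    ≡⟨ ∑-cong (homs s G) (λ f → trans (≡.sym (∑-*ˡ (nbrs G (map (vlookup f) N)) (∏ m f) _))
         (∑-cong (nbrs G (map (vlookup f) N)) λ i → reorder (∏ m f) (m i) (w (i ∷ f)))) ⟩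
  ∑ (homs s G) (λ f → ∑ (nbrs G (map (vlookup f) N)) (λ i → m i * ∏ m f * w (i ∷ f)))
    ≡⟨ ∑-▷ s N G _ ⟨
  ∑ (homs (s ▷ N) G) (λ f → ∏ m f * w f) ∎
  where
  open ≡-Reasoning
  B = blowup G m
  κ = lookup (copies m)

  w′ : Vec (Fin (n G)) _ → ℕ
  w′ f = ∑ (nbrs G (map (vlookup f) N)) (λ i → m i * w (i ∷ f))

  reorder : ∀ a b c → a * (b * c) ≡ b * a * c
  reorder a b c = trans (≡.sym (*-assoc a b c)) (cong (_* c) (*-comm a b))

  if-* : ∀ b c d → c * (if b then d else 0) ≡ (if b then c * d else 0)
  if-* true  c d = refl
  if-* false c d = *-zeroʳ c

  joined-κ : ∀ f x → joined (adj B) (map (vlookup f) N) x ≡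
                     joined (adj G) (map (vlookup (Vec.map κ f)) N) (κ x)
  joined-κ f x = cong andAll (trans (≡.sym (map-∘ N))
    (trans (map-cong (λ j → cong (adj G (κ x)) (≡.sym (vlookup-map κ f j))) N) (map-∘ N)))

  step : ∀ f → ∑ (nbrs B (map (vlookup f) N)) (λ x → w (κ x ∷ Vec.map κ f)) ≡ w′ (Vec.map κ f)
  step f = begin
    ∑ (nbrs B (map (vlookup f) N)) (λ x → w (κ x ∷ g))
      ≡⟨ ∑-filter (joined (adj B) (map (vlookup f) N)) (allFin (n B)) _ ⟩
    ∑ (allFin (n B)) (λ x → if joined (adj B) (map (vlookup f) N) x then w (κ x ∷ g) else 0)
      ≡⟨ ∑-cong (allFin (n B)) (λ x → cong (if_then w (κ x ∷ g) else 0) (joined-κ f x)) ⟩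
    ∑ (allFin (n B)) (λ x → if ok (κ x) then w (κ x ∷ g) else 0)
      ≡⟨ ∑-allFin-lookup (copies m) (λ i → if ok i then w (i ∷ g) else 0) ⟩
    ∑ (copies m) (λ i → if ok i then w (i ∷ g) else 0)
      ≡⟨ ∑-copies m _ ⟩
    ∑ (allFin (n G)) (λ i → m i * (if ok i then w (i ∷ g) else 0))
      ≡⟨ ∑-cong (allFin (n G)) (λ i → if-* (ok i) (m i) (w (i ∷ g))) ⟩
    ∑ (allFin (n G)) (λ i → if ok i then m i * w (i ∷ g) else 0)
      ≡⟨ ∑-filter ok (allFin (n G)) _ ⟨
    w′ g ∎
    where
    g = Vec.map κ f

    ok : Fin (n G) → Bool
    ok = joined (adj G) (map (vlookup g) N)

hom-blowup : ∀ {k} (s : Build k) G m → hom ⟦ s ⟧ (blowup G m) ≡ ∑ (homs s G) (∏ m)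
hom-blowup s G m = trans (hom≡∑ s (blowup G m))
  (trans (∑-homs-blowup s G m (λ _ → 1)) (∑-cong (homs s G) λ f → *-identityʳ (∏ m f)))

-- The test graphs

-- H was found by a computer search: the identity is its only homomorphism to
-- Host, and no vertex of H is adjacent to t₁ or t₂ and to all of Γ, Δ or B.
H : Build 8
H = ε ▷ [] ▷ # 0 ∷ [] ▷ # 0 ∷ # 1 ∷ [] ▷ # 0 ∷ # 1 ∷ [] ▷ # 0 ∷ # 1 ∷ []
      ▷ # 0 ∷ # 4 ∷ [] ▷ # 0 ∷ # 1 ∷ [] ▷ # 0 ∷ # 1 ∷ # 5 ∷ []

t₁ t₂ : Fin 8
t₁ = # 4
t₂ = # 5

T Γ Δ B : List (Fin 8)
T = # 3 ∷ # 6 ∷ []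
Γ = # 1 ∷ # 7 ∷ []
Δ = # 2 ∷ # 7 ∷ []
B = # 0 ∷ # 3 ∷ []

↑ : ∀ k → List (Fin 8) → List (Fin (k + 8))
↑ k = map (k ↑ʳ_)

-- The two added vertices lie in N(t₁, Δ) and N(t₂, B). As the sizes of these sets enter the count
-- as factors, a count of 1 makes both of them singletons.
C : Build 10
C = H ▷ t₁ ∷ Δ ▷ ↑ 1 (t₂ ∷ B)

Fᵃ Fᵇ D : Build 11
Fᵃ = C ▷ ↑ 2 (t₁ ∷ Γ)
Fᵇ = C ▷ ↑ 2 (t₂ ∷ Γ)
D  = C ▷ ↑ 2 T

-- `# 0` to `# 3` all denote the vertex that `D` adds, whose image will be that of `t₁` or `t₂`. Two
-- vertices attached to `B` produce the square.
Fᶜ : Build 15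
Fᶜ = D ▷ # 0 ∷ ↑ 3 Γ ▷ # 1 ∷ ↑ 4 Δ ▷ # 2 ∷ ↑ 5 B ▷ # 3 ∷ ↑ 6 B

-- The four added vertices will be repeated `a`, `b`, `x` and `y` times, to become the sets N(t₁,
-- Γ), N(t₂, Γ), N(t₁, B) and N(t₂, Δ).
Host : Build 14
Host = C ▷ ↑ 2 (t₁ ∷ Γ) ▷ ↑ 3 (t₂ ∷ Γ) ▷ ↑ 4 (t₁ ∷ B) ▷ ↑ 5 (t₂ ∷ Δ)

-- The homomorphisms from the test graphs to Host are obtained by evaluation.
module Solution⇒Graph (a b x y : ℕ) where
  mult : Fin 14 → ℕ
  -- Index zero is the vertex added last, so the multiplicities run against the order of `Host`.
  mult = Vec.lookup (y ∷ x ∷ b ∷ a ∷ Vec.replicate 10 1)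

  G : Graph
  G = blowup ⟦ Host ⟧ mult

  hom-C : hom ⟦ C ⟧ G ≡ 1
  hom-C = hom-blowup C ⟦ Host ⟧ mult

  hom-D : hom ⟦ D ⟧ G ≡ 2
  hom-D = hom-blowup D ⟦ Host ⟧ mult

  hom-Fᵃ : hom ⟦ Fᵃ ⟧ G ≡ a
  hom-Fᵃ = trans (hom-blowup Fᵃ ⟦ Host ⟧ mult) (trans (+-identityʳ (a * 1)) (*-identityʳ a))

  hom-Fᵇ : hom ⟦ Fᵇ ⟧ G ≡ b
  hom-Fᵇ = trans (hom-blowup Fᵇ ⟦ Host ⟧ mult) (trans (+-identityʳ (b * 1)) (*-identityʳ b))

  hom-Fᶜ : hom ⟦ Fᶜ ⟧ G ≡ a * (x * x) + b * y
  hom-Fᶜ = trans (hom-blowup Fᶜ ⟦ Host ⟧ mult) (solve 4 (λ a b x y →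
      -- The two summands belong to the homomorphisms that send the vertex added by `D` to `t₁` and
      -- to `t₂`.
      x :* (x :* (con 1 :* (a :* con 1))) :+ (con 1 :* (con 1 :* (y :* (b :* con 1))) :+ con 0) :=
      a :* (x :* x) :+ b :* y) refl a b x y)
    where open +-*-Solver using (solve; con; _:+_; _:*_; _:=_)

-- A sum of naturals equal to 1 has exactly one nonzero term, so the weights `w` turn every sum into
-- a single evaluation. Applied to `weight`, this singles out the one homomorphism `h` from `H` that
-- extends to `C`.
∑-unit : ∀ {A : Set} (xs : List A) (w : A → ℕ) → ∑ xs w ≡ 1 →
         ∃[ x ] x ∈ xs × w x ≡ 1 × (∀ (v : _ → ℕ) → ∑ xs (λ y → w y * v y) ≡ v x)
∑-unit (x ∷ xs) w e with w x in wx
... | zero = let y , y∈ , wy , pick = ∑-unit xs w e in y , there y∈ , wy , pick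
... | suc zero = x , here refl , wx , λ v → begin
  1 * v x + ∑ xs (λ y → w y * v y)
    ≡⟨ cong₂ _+_ (*-identityˡ (v x)) (rest xs (suc-injective e) v) ⟩
  v x + 0
    ≡⟨ +-identityʳ (v x) ⟩
  v x ∎
  where
  open ≡-Reasoning
  rest : ∀ ys → ∑ ys w ≡ 0 → ∀ (v : _ → ℕ) → ∑ ys (λ y → w y * v y) ≡ 0
  rest []       _ v = refl
  rest (y ∷ ys) p v =
    cong₂ (λ k l → k * v y + l) (m+n≡0⇒m≡0 (w y) p) (rest ys (m+n≡0⇒n≡0 (w y) p) v)

∑-pair : ∀ {A : Set} (xs : List A) {i j} → length xs ≡ 2 → i ∈ xs → j ∈ xs → i ≢ j →
         ∀ (w : A → ℕ) → ∑ xs w ≡ w i + w j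
∑-pair (p ∷ q ∷ []) e (here refl)         (here refl)         i≢j w = contradiction refl i≢j
∑-pair (p ∷ q ∷ []) e (here refl)         (there (here refl)) i≢j w = cong (w p +_) (+-identityʳ (w q))
∑-pair (p ∷ q ∷ []) e (there (here refl)) (here refl)         i≢j w =
  trans (cong (w p +_) (+-identityʳ (w q))) (+-comm (w p) (w q))
∑-pair (p ∷ q ∷ []) e (there (here refl)) (there (here refl)) i≢j w = contradiction refl i≢j

-- The constraints on C and D determine the images of all vertices of C and
-- leave the images of t₁ and t₂ as the only candidates for the new vertex of D.
module Graph⇒Solution (G : Graph) {a b c : ℕ}
  (hom-C : hom ⟦ C ⟧ G ≡ 1) (hom-D : hom ⟦ D ⟧ G ≡ 2)
  (hom-Fᵃ : hom ⟦ Fᵃ ⟧ G ≡ a) (hom-Fᵇ : hom ⟦ Fᵇ ⟧ G ≡ b) (hom-Fᶜ : hom ⟦ Fᶜ ⟧ G ≡ c) where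

  private
    V = Fin (n G)

  codeg : List V → ℕ
  codeg zs = length (nbrs G zs)

  image : ∀ {k} → Vec V k → List (Fin k) → List V
  image h = map (vlookup h)

  -- As the weight ignores the new vertex, the choice of its image only contributes the number of
  -- candidates.
  ∑-leaf : ∀ {k} (s : Build k) N {w : Vec V (suc k) → ℕ} {v : Vec V k → ℕ} →
           (∀ x f → w (x ∷ f) ≡ v f) →
           ∑ (homs (s ▷ N) G) w ≡ ∑ (homs s G) (λ f → codeg (image f N) * v f)
  ∑-leaf s N {w} {v} e = trans (∑-▷ s N G w) (∑-cong (homs s G) λ f →
    trans (∑-cong (nbrs G (image f N)) λ x → e x f) (∑-const (nbrs G (image f N)) (v f)))

  -- For a homomorphism `h` from `H`, the number of its extensions to `C`: the two further vertices
  -- are not adjacent, so they are placed independently.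
  weight : Vec V 8 → ℕ
  weight h = codeg (image h (t₁ ∷ Δ)) * codeg (image h (t₂ ∷ B))

  ∑-C : ∀ {w : Vec V 10 → ℕ} {v : Vec V 8 → ℕ} → (∀ x y h → w (x ∷ y ∷ h) ≡ v h) →
        ∑ (homs C G) w ≡ ∑ (homs H G) (λ h → weight h * v h)
  ∑-C {w} {v} e = begin
    ∑ (homs C G) w
      ≡⟨ ∑-leaf (H ▷ t₁ ∷ Δ) (↑ 1 (t₂ ∷ B)) {v = v ∘ Vec.tail} (λ { x (y ∷ h) → e x y h }) ⟩
    ∑ (homs (H ▷ t₁ ∷ Δ) G) (λ f → codeg (image f (↑ 1 (t₂ ∷ B))) * v (Vec.tail f))
      ≡⟨ ∑-leaf H (t₁ ∷ Δ) {v = λ h → codeg (image h (t₂ ∷ B)) * v h} (λ _ _ → refl) ⟩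
    ∑ (homs H G) (λ h → codeg (image h (t₁ ∷ Δ)) * (codeg (image h (t₂ ∷ B)) * v h))
      ≡⟨ ∑-cong (homs H G) (λ h → *-assoc (codeg (image h (t₁ ∷ Δ))) _ (v h)) ⟨
    ∑ (homs H G) (λ h → weight h * v h) ∎
    where open ≡-Reasoning

  ∑-C▷ : ∀ N {w : Vec V 11 → ℕ} {v : V → Vec V 8 → ℕ} → (∀ z x y h → w (z ∷ x ∷ y ∷ h) ≡ v z h) →
         ∑ (homs (C ▷ ↑ 2 N) G) w ≡ ∑ (homs H G) (λ h → weight h * ∑ (nbrs G (image h N)) (λ z → v z h))
  ∑-C▷ N {w} {v} e = trans (∑-▷ C (↑ 2 N) G w) (∑-C λ x y h →
    trans (cong (λ zs → ∑ (nbrs G zs) (λ z → w (z ∷ x ∷ y ∷ h))) (≡.sym (map-∘ N)))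
          (∑-cong (nbrs G (image h N)) λ z → e z x y h))

  -- With the vertex of `D` placed at `z`, the number of ways to place the last four vertices of
  -- `Fᶜ`; the bracketing is the one that repeated use of `∑-leaf` leaves.
  spread : V → Vec V 8 → ℕ
  spread z h = codeg (z ∷ image h Γ) * (codeg (z ∷ image h Δ) *
               (codeg (z ∷ image h B) * (codeg (z ∷ image h B) * 1)))

  private
    unique-core : ∃[ h ] h ∈ homs H G × weight h ≡ 1 ×
                  (∀ (v : _ → ℕ) → ∑ (homs H G) (λ f → weight f * v f) ≡ v h)
    unique-core = ∑-unit (homs H G) weight (begin
      ∑ (homs H G) weight               ≡⟨ ∑-cong (homs H G) (λ h → *-identityʳ (weight h)) ⟨
      ∑ (homs H G) (λ h → weight h * 1) ≡⟨ ∑-C (λ _ _ _ → refl) ⟨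
      ∑ (homs C G) (λ _ → 1)            ≡⟨ hom≡∑ C G ⟨
      hom ⟦ C ⟧ G                       ≡⟨ hom-C ⟩
      1                                 ∎)
      where open ≡-Reasoning

  h : Vec V 8
  h = proj₁ unique-core

  h-edge : Preserves ⟦ H ⟧ G h
  h-edge = homs-preserve H G (proj₁ (proj₂ unique-core))

  pick : ∀ (v : Vec V 8 → ℕ) → ∑ (homs H G) (λ f → weight f * v f) ≡ v h
  pick = proj₂ (proj₂ (proj₂ unique-core))

  e₁-unique : codeg (image h (t₁ ∷ Δ)) ≡ 1
  e₁-unique = m*n≡1⇒m≡1 _ _ (proj₁ (proj₂ (proj₂ unique-core)))

  e₂-unique : codeg (image h (t₂ ∷ B)) ≡ 1
  e₂-unique = m*n≡1⇒n≡1 (codeg (image h (t₁ ∷ Δ))) _ (proj₁ (proj₂ (proj₂ unique-core)))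

  -- Once `pick` has fixed the image of `H`, the counts for `D`, `Fᵃ` and `Fᵇ` each measure one set
  -- of common neighbours.
  hom-C▷ : ∀ N → hom ⟦ C ▷ ↑ 2 N ⟧ G ≡ codeg (image h N)
  hom-C▷ N = trans (hom≡∑ (C ▷ ↑ 2 N) G) (trans (∑-C▷ N (λ _ _ _ _ → refl))
    (trans (pick λ h → ∑ (nbrs G (image h N)) (λ _ → 1))
    (trans (∑-const (nbrs G (image h N)) 1) (*-identityʳ (codeg (image h N))))))

  ∑-Fᶜ : ∑ (homs Fᶜ G) (λ _ → 1) ≡
         ∑ (homs H G) (λ h → weight h * ∑ (nbrs G (image h T)) (λ z → spread z h))
  ∑-Fᶜ =
    -- Vertices are removed from the last to the first, so the index of the vertex added by `D`
    -- falls from 3 to 0.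
    trans (∑-leaf D₃ (# 3 ∷ ↑ 6 B) {v = λ _ → 1} λ _ _ → refl)
    (trans (∑-leaf D₂ (# 2 ∷ ↑ 5 B) {v = λ f → cd f (# 2 ∷ ↑ 5 B) * 1} λ _ _ → refl)
    (trans (∑-leaf D₁ (# 1 ∷ ↑ 4 Δ)
      {v = λ f → cd f (# 1 ∷ ↑ 4 B) * (cd f (# 1 ∷ ↑ 4 B) * 1)} λ _ _ → refl)
    (trans (∑-leaf D (# 0 ∷ ↑ 3 Γ)
      {v = λ f → cd f (# 0 ∷ ↑ 3 Δ) * (cd f (# 0 ∷ ↑ 3 B) * (cd f (# 0 ∷ ↑ 3 B) * 1))} λ _ _ → refl)
    (∑-C▷ T λ _ _ _ _ → refl))))
    where
    D₁ = D ▷ # 0 ∷ ↑ 3 Γ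
    D₂ = D₁ ▷ # 1 ∷ ↑ 4 Δ
    D₃ = D₂ ▷ # 2 ∷ ↑ 5 B

    cd : ∀ {k} → Vec V k → List (Fin k) → ℕ
    cd f N = codeg (image f N)

  τ₁ τ₂ : V
  τ₁ = vlookup h t₁
  τ₂ = vlookup h t₂

  h-nbrs : ∀ N t → All (λ z → badj H t z ≡ true) N → vlookup h t ∈ nbrs G (image h N)
  h-nbrs N t adjacent = ∈-filter⁺ (λ x → joined (adj G) (image h N) x ≟B true) (∈-allFin _)
    (andAll-intro (All.map⁺ (All.map⁺ (All.map (h-edge t _) adjacent))))

  -- `t₁` and `t₂` are adjacent in `H`, and `G` has no loops.
  τ₁≢τ₂ : τ₁ ≢ τ₂
  τ₁≢τ₂ e = contradiction
    (trans (≡.sym (h-edge t₁ t₂ refl)) (trans (cong (adj G τ₁) (≡.sym e)) (irrefl G τ₁))) λ ()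

  solution : ∃[ x ] ∃[ y ] a * (x * x) + b * y ≡ c
  solution = codeg (τ₁ ∷ image h B) , codeg (τ₂ ∷ image h Δ) , (begin
    a * (x * x) + b * y
      ≡⟨ solve 4 (λ a b x y → a :* (x :* x) :+ b :* y :=
           a :* (con 1 :* (x :* (x :* con 1))) :+ b :* (y :* (con 1 :* (con 1 :* con 1)))) refl a b x y ⟩
    a * (1 * (x * (x * 1))) + b * (y * (1 * (1 * 1)))
      -- N(t₁, Γ) has `a` elements by `Fᵃ`, and the factor 1 is the size of N(t₁, Δ).
      ≡⟨ cong₂ (λ k l → k * (l * (x * (x * 1))) + b * (y * (1 * (1 * 1))))
           (trans (≡.sym hom-Fᵃ) (hom-C▷ (t₁ ∷ Γ))) (≡.sym e₁-unique) ⟩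
    spread τ₁ h + b * (y * (1 * (1 * 1)))
      ≡⟨ cong₂ (λ k l → spread τ₁ h + k * (y * (l * (l * 1))))
           (trans (≡.sym hom-Fᵇ) (hom-C▷ (t₂ ∷ Γ))) (≡.sym e₂-unique) ⟩
    spread τ₁ h + spread τ₂ h
      ≡⟨ ∑-pair (nbrs G (image h T)) (trans (≡.sym (hom-C▷ T)) hom-D)
           (h-nbrs T t₁ (refl ∷ refl ∷ [])) (h-nbrs T t₂ (refl ∷ refl ∷ [])) τ₁≢τ₂ (λ z → spread z h) ⟨
    ∑ (nbrs G (image h T)) (λ z → spread z h)
      ≡⟨ pick (λ h → ∑ (nbrs G (image h T)) (λ z → spread z h)) ⟨
    ∑ (homs H G) (λ h → weight h * ∑ (nbrs G (image h T)) (λ z → spread z h))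
      ≡⟨ ∑-Fᶜ ⟨
    ∑ (homs Fᶜ G) (λ _ → 1)
      ≡⟨ hom≡∑ Fᶜ G ⟨
    hom ⟦ Fᶜ ⟧ G
      ≡⟨ hom-Fᶜ ⟩
    c ∎)
    where
    open ≡-Reasoning
    open +-*-Solver using (solve; con; _:+_; _:*_; _:=_)
    x = codeg (τ₁ ∷ image h B)
    y = codeg (τ₂ ∷ image h Δ)

-- Binary words

data Bit : Sym → Set where
  bit0 : Bit b0
  bit1 : Bit b1

-- What is known about a numeral after its digits have been read from the least
-- significant end: nothing was read, only the digit 0, a word with leading
-- digit 1, or a longer word with leading digit 0.
data Status : Set where
  none only0 lead1 lead0 : Status

next : Status → Sym → Status
next _    b1  = lead1
next none b0  = only0
next _    b0  = lead0
next st   sep = st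

status : Status → Word → Status
status = foldl next

canonical : Status → Bool
canonical only0 = true
canonical lead1 = true
canonical _     = false

-- Least significant digit first, the order in which `binAux` emits digits and the machine meets
-- them.
value : Word → ℕ
value []       = 0
value (b1 ∷ v) = 1 + value v * 2
value (_  ∷ v) = value v * 2

parity : ℕ → Sym
parity m = if (m % 2) ≡ᵇ 0 then b0 else b1

parity-bit : ∀ m → Bit (parity m)
parity-bit m with (m % 2) ≡ᵇ 0
... | true  = bit0
... | false = bit1

binAux-bits : ∀ f m → All Bit (binAux f m)
binAux-bits zero    m       = []
binAux-bits (suc f) zero    = []
binAux-bits (suc f) (suc m) = parity-bit (suc m) ∷ binAux-bits f (suc m / 2)

binAux-0 : ∀ f → binAux f 0 ≡ []
binAux-0 zero    = refl
binAux-0 (suc f) = refl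

-- Halving lowers a positive number, so fuel that covers the number still covers its half after one
-- unit is spent.
half≤ : ∀ f m → suc m ≤ suc f → suc m / 2 ≤ f
half≤ f m (s≤s m≤f) = ≤-trans (≤-pred (m/n<m (suc m) 2 (s≤s (s≤s z≤n)))) m≤f

-- Halving reaches 0 only from 1, so the last digit produced is 1, whatever was read before.
status-binAux : ∀ f m st → suc m ≤ f → status st (binAux f (suc m)) ≡ lead1
status-binAux (suc f) m st m≤f with suc m / 2 in e | half≤ f m m≤f
status-binAux (suc f) zero    st m≤f | zero  | _ rewrite binAux-0 f = refl
status-binAux (suc f) (suc m) st m≤f | zero  | _ with s≤s (s≤s ()) ← m/n≡0⇒m<n {suc (suc m)} {2} e
status-binAux (suc f) m       st m≤f | suc k | k<f = status-binAux f k _ k<f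

value-∷ : ∀ m v → value (parity m ∷ v) ≡ m % 2 + value v * 2
value-∷ m v with m % 2 | m%n<n m 2
... | zero        | _ = refl
... | suc zero    | _ = refl
... | suc (suc _) | s≤s (s≤s ())

value-binAux : ∀ f m → m ≤ f → value (binAux f m) ≡ m
value-binAux zero    zero    _   = refl
value-binAux (suc f) zero    _   = refl
value-binAux (suc f) (suc m) m≤f = begin
  value (parity (suc m) ∷ binAux f (suc m / 2)) ≡⟨ value-∷ (suc m) _ ⟩
  suc m % 2 + value (binAux f (suc m / 2)) * 2
    ≡⟨ cong (λ k → suc m % 2 + k * 2) (value-binAux f (suc m / 2) (half≤ f m m≤f)) ⟩
  suc m % 2 + (suc m / 2) * 2                   ≡⟨ m≡m%n+[m/n]*n (suc m) 2 ⟨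
  suc m                                         ∎
  where open ≡-Reasoning

reverse-bits : ∀ {v} → All Bit v → All Bit (reverse v)
reverse-bits = All-resp-↭ (↭-sym (↭-reverse _))

bin-bits : ∀ m → All Bit (bin m)
bin-bits zero    = bit0 ∷ []
bin-bits (suc m) = reverse-bits (binAux-bits (suc m) (suc m))

bin-canonical : ∀ m → canonical (status none (reverse (bin m))) ≡ true
bin-canonical zero    = refl
bin-canonical (suc m) = cong canonical (trans (cong (status none) (reverse-involutive (binAux (suc m) (suc m))))
  (status-binAux (suc m) m none ≤-refl))

value-bin : ∀ m → value (reverse (bin m)) ≡ m
value-bin zero    = refl
value-bin (suc m) = trans (cong value (reverse-involutive (binAux (suc m) (suc m)))) (value-binAux (suc m) (suc m) ≤-refl)

-- `only0` is entered only from `none`, and every further digit leaves it for good.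
status-only0 : ∀ v st → All Bit v → status st v ≡ only0 →
               (v ≡ [] × st ≡ only0) ⊎ (v ≡ b0 ∷ [] × st ≡ none)
status-only0 []       st    bits          e = inj₁ (refl , e)
status-only0 (d ∷ v)  st    (p ∷ bits)    e with status-only0 v (next st d) bits e
status-only0 (b0 ∷ _) none  (bit0 ∷ bits) e | inj₁ (refl , refl) = inj₂ (refl , refl)
status-only0 (b0 ∷ v) none  (bit0 ∷ bits) e | inj₂ (_ , ())
status-only0 (b0 ∷ v) only0 (bit0 ∷ bits) e | inj₂ (_ , ())
status-only0 (b0 ∷ v) lead1 (bit0 ∷ bits) e | inj₂ (_ , ())
status-only0 (b0 ∷ v) lead0 (bit0 ∷ bits) e | inj₂ (_ , ())
status-only0 (b1 ∷ v) st    (bit1 ∷ bits) e | inj₁ (_ , ())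
status-only0 (b1 ∷ v) st    (bit1 ∷ bits) e | inj₂ (_ , ())

binAux-even : ∀ f k → 0 < k → binAux (suc f) (k * 2) ≡ b0 ∷ binAux f k
binAux-even f (suc k) _ = cong₂ _∷_
  (cong (λ r → if r ≡ᵇ 0 then b0 else b1) (m*n%n≡0 (suc k) 2))
  (cong (binAux f) (m*n/n≡m (suc k) 2))

binAux-odd : ∀ f k → binAux (suc f) (1 + k * 2) ≡ b1 ∷ binAux f k
binAux-odd f k = cong₂ _∷_
  (cong (λ r → if r ≡ᵇ 0 then b0 else b1) ([m+kn]%n≡m%n 1 k 2))
  (cong (binAux f) (trans (+-distrib-/ 1 (k * 2) (s≤s (s≤s (≤-reflexive (m*n%n≡0 k 2))))) (m*n/n≡m k 2)))

-- The empty word remains possible because `st` may already be `lead1`. Positivity is carried along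
-- for the digit 0: doubling the value 0 would make `binAux` stop instead of emitting it.
binAux-value : ∀ v st → All Bit v → status st v ≡ lead1 →
               v ≡ [] ⊎ (0 < value v × (∀ f → value v ≤ f → binAux f (value v) ≡ v))
binAux-value []       st bits          e = inj₁ refl
binAux-value (d ∷ v)  st (p ∷ bits)    e with binAux-value v (next st d) bits e
binAux-value (b0 ∷ _) st (bit0 ∷ bits) e | inj₁ refl with st | e
... | none  | ()
... | only0 | ()
... | lead1 | ()
... | lead0 | ()
binAux-value (b0 ∷ v) st (bit0 ∷ bits) e | inj₂ (pos , ih) = inj₂ (*-monoˡ-< 2 pos , step)
  where
  step : ∀ f → value v * 2 ≤ f → binAux f (value v * 2) ≡ b0 ∷ v
  step zero    v≤0 with () ← ≤-trans (*-monoˡ-< 2 pos) v≤0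
  step (suc f) v≤f = trans (binAux-even f (value v) pos)
    (cong (b0 ∷_) (ih f (≤-pred (≤-trans (m<m*n (value v) 2 {{>-nonZero pos}} (s≤s (s≤s z≤n))) v≤f))))
binAux-value (b1 ∷ v) st (bit1 ∷ bits) e | r = inj₂ (s≤s z≤n , step r)
  where
  step : v ≡ [] ⊎ (0 < value v × (∀ f → value v ≤ f → binAux f (value v) ≡ v)) →
         ∀ f → 1 + value v * 2 ≤ f → binAux f (1 + value v * 2) ≡ b1 ∷ v
  step r           (suc f) v≤f with binAux-odd f (value v)
  step (inj₁ refl) (suc f) v≤f | q = trans q (cong (b1 ∷_) (binAux-0 f))
  step (inj₂ (_ , ih)) (suc f) (s≤s v≤f) | q =
    trans q (cong (b1 ∷_) (ih f (≤-trans (m≤m*n (value v) 2) v≤f)))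

-- With `bin-canonical` this shows that, among words of bits, the finite-state test `canonical`
-- accepts exactly the reversed numerals.
bin-value : ∀ v → All Bit v → canonical (status none v) ≡ true → bin (value v) ≡ reverse v
bin-value v bits ok with status none v in e
bin-value v bits refl | only0 with status-only0 v none bits e
... | inj₂ (refl , _) = refl
bin-value v bits refl | lead1 with binAux-value v none bits e
... | inj₁ refl with () ← e
... | inj₂ (pos , q) with value v | pos | q
...   | suc k | _ | q = cong reverse (q (suc k) ≤-refl)

reverse-bin-value : ∀ v → All Bit v → canonical (status none v) ≡ true → v ≡ reverse (bin (value v))
reverse-bin-value v bits ok = ≡.sym (trans (cong reverse (bin-value v bits ok)) (reverse-involutive v))

-- Unique decoding

bin-injective : ∀ {m m′} → bin m ≡ bin m′ → m ≡ m′
bin-injective {m} {m′} e = trans (≡.sym (value-bin m)) (trans (cong (value ∘ reverse) e) (value-bin m′))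

bits-sep-injective : ∀ {v v′ u u′} → All Bit v → All Bit v′ →
                     v ++ sep ∷ u ≡ v′ ++ sep ∷ u′ → v ≡ v′ × u ≡ u′
bits-sep-injective []         []         refl = refl , refl
bits-sep-injective []         (() ∷ _)   refl
bits-sep-injective (() ∷ _)   []         refl
bits-sep-injective (_ ∷ bits) (_ ∷ bits′) e with refl , e′ ← ∷-injective e
  with refl , refl ← bits-sep-injective bits bits′ e′ = refl , refl

bin-sep-injective : ∀ m m′ {u u′} → bin m ++ sep ∷ u ≡ bin m′ ++ sep ∷ u′ → m ≡ m′ × u ≡ u′
bin-sep-injective m m′ e with p , q ← bits-sep-injective (bin-bits m) (bin-bits m′) e =
  bin-injective p , q

bin-sep-head : ∀ m {u w} → bin m ++ sep ∷ u ≢ sep ∷ w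
bin-sep-head m e with bin m in eq | bin-bits m
... | []    | _ with () ← trans (≡.sym (bin-canonical m)) (cong (canonical ∘ status none ∘ reverse) eq)
bin-sep-head m refl | _ ∷ _ | () ∷ _

bin-sep≢[] : ∀ m {u} → bin m ++ sep ∷ u ≢ []
bin-sep≢[] m e with bin m
bin-sep≢[] m () | []
bin-sep≢[] m () | _ ∷ _

-- Makes every word with a leading separator a negative instance of `HomRec`, fit to be the answer
-- to malformed input.
encPairs-head : ∀ {k} (ps : List (Fin k × ℕ)) {w} → encPairs ps ≢ sep ∷ w
encPairs-head ((i , h) ∷ ps) = bin-sep-head (toℕ i)

-- `HomRec` accepts a word as soon as some list encoded by it is realisable, so that list has to be
-- the intended one.
encPairs-injective : ∀ {k} (ps ps′ : List (Fin k × ℕ)) → encPairs ps ≡ encPairs ps′ → ps ≡ ps′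
encPairs-injective []             []               e = refl
encPairs-injective []             ((i , h) ∷ ps)   e = contradiction (≡.sym e) (bin-sep≢[] (toℕ i))
encPairs-injective ((i , h) ∷ ps) []               e = contradiction e (bin-sep≢[] (toℕ i))
encPairs-injective ((i , h) ∷ ps) ((i′ , h′) ∷ ps′) e
  with p , e₁ ← bin-sep-injective (toℕ i) (toℕ i′) e
  with q , e₂ ← bin-sep-injective h h′ e₁ =
  cong₂ _∷_ (cong₂ _,_ (Fin.toℕ-injective p) q) (encPairs-injective ps ps′ e₂)

split-sep : ∀ u → ∃[ v ] All Bit v × (u ≡ v ⊎ ∃[ u′ ] u ≡ v ++ sep ∷ u′)
split-sep []        = [] , [] , inj₁ refl
split-sep (sep ∷ u) = [] , [] , inj₂ (u , refl)
split-sep (b0 ∷ u) with split-sep u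
... | v , bits , inj₁ e        = b0 ∷ v , bit0 ∷ bits , inj₁ (cong (b0 ∷_) e)
... | v , bits , inj₂ (u′ , e) = b0 ∷ v , bit0 ∷ bits , inj₂ (u′ , cong (b0 ∷_) e)
split-sep (b1 ∷ u) with split-sep u
... | v , bits , inj₁ e        = b1 ∷ v , bit1 ∷ bits , inj₁ (cong (b1 ∷_) e)
... | v , bits , inj₂ (u′ , e) = b1 ∷ v , bit1 ∷ bits , inj₂ (u′ , cong (b1 ∷_) e)

-- The word function computed by the machine

-- The number of the input a#b#c that is being read; it is read from the right.
data Phase : Set where
  inA inB inC : Phase

-- 11#1#100#10#10#, that is, the pairs (3, 1) and (4, 2), followed by the index 2.
prefix : Vec Sym 15
prefix = b1 ∷ b1 ∷ sep ∷ b1 ∷ sep ∷ b1 ∷ b0 ∷ b0 ∷ sep ∷ b1 ∷ b0 ∷ sep ∷ b1 ∷ b0 ∷ sep ∷ []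

accept : Phase → Bool → Word → Maybe Word
accept inA true V = just (Vec.toList prefix ++ V)
accept _   _    V = nothing

-- The word u is the unread input, reversed; V is the part of the answer that is
-- already known. The separators are expanded to #0# and #1#, which completes
-- the pair on the right and supplies its index.
process : Phase → Status → Word → Word → Maybe Word
separator : Phase → Bool → Word → Word → Maybe Word

process p st V []        = accept p (canonical st) V
process p st V (b0 ∷ u)  = process p (next st b0) (b0 ∷ V) u
process p st V (b1 ∷ u)  = process p (next st b1) (b1 ∷ V) u
process p st V (sep ∷ u) = separator p (canonical st) V u

separator inC true V u = process inB none (sep ∷ b0 ∷ sep ∷ V) u
separator inB true V u = process inA none (sep ∷ b1 ∷ sep ∷ V) u
separator _   _    V u = nothing

translate : Word → Maybe Word
-- The initial separator closes the last pair, the one holding `c`.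
translate w = process inC none (sep ∷ []) (reverse w)

process-bits : ∀ p st V v u → All Bit v →
               process p st V (v ++ u) ≡ process p (status st v) (reverse v ++ V) u
process-bits p st V []      u []            = refl
process-bits p st V (d ∷ v) u (bit ∷ bits) = trans (first bit)
  (trans (process-bits p (next st d) (d ∷ V) v u bits)
         (cong (λ X → process p (status st (d ∷ v)) X u) (reverse-∷-++ v)))
  where
  first : ∀ {d} → Bit d → process p st V (d ∷ v ++ u) ≡ process p (next st d) (d ∷ V) (v ++ u)
  first bit0 = refl
  first bit1 = refl

  reverse-∷-++ : ∀ v → reverse v ++ d ∷ V ≡ reverse (d ∷ v) ++ V
  reverse-∷-++ v = trans (≡.sym (++-assoc (reverse v) (d ∷ []) V))
                      (cong (_++ V) (≡.sym (unfold-reverse d v)))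

query : ℕ → ℕ → ℕ → Word
query a b c = bin a ++ sep ∷ bin b ++ sep ∷ bin c

-- Bracketed so as to be definitionally equal to `encPairs (pairs a b c)`.
answer : ℕ → ℕ → ℕ → Word
answer a b c = Vec.toList prefix ++
  (bin a ++ sep ∷ b1 ∷ sep ∷ (bin b ++ sep ∷ b0 ∷ sep ∷ (bin c ++ sep ∷ [])))

query-injective : ∀ {a b c a′ b′ c′} → query a b c ≡ query a′ b′ c′ → a ≡ a′ × b ≡ b′ × c ≡ c′
query-injective {a} {b} {a′ = a′} {b′} e
  with p , e₁ ← bin-sep-injective a a′ e with q , e₂ ← bin-sep-injective b b′ e₁ =
  p , q , bin-injective e₂

reverse-sep : ∀ (v w : Word) → reverse (v ++ sep ∷ w) ≡ reverse w ++ sep ∷ reverse v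
reverse-sep v w = begin
  reverse (v ++ sep ∷ w)                ≡⟨ reverse-++ v (sep ∷ w) ⟩
  reverse (sep ∷ w) ++ reverse v        ≡⟨ cong (_++ reverse v) (unfold-reverse sep w) ⟩
  (reverse w ++ sep ∷ []) ++ reverse v  ≡⟨ ++-assoc (reverse w) (sep ∷ []) (reverse v) ⟩
  reverse w ++ sep ∷ reverse v          ∎
  where open ≡-Reasoning

reverse-query : ∀ a b c →
  reverse (query a b c) ≡ reverse (bin c) ++ sep ∷ (reverse (bin b) ++ sep ∷ reverse (bin a))
reverse-query a b c = trans (reverse-sep (bin a) _) (trans
  (cong (_++ sep ∷ reverse (bin a)) (reverse-sep (bin b) (bin c)))
  (++-assoc (reverse (bin c)) _ _))

translate-query : ∀ a b c → translate (query a b c) ≡ just (answer a b c)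
translate-query a b c = begin
  process inC none V₀ (reverse (query a b c))
    ≡⟨ cong (process inC none V₀) (reverse-query a b c) ⟩
  process inC none V₀ (vc ++ sep ∷ (vb ++ sep ∷ va))
    ≡⟨ process-bits inC none V₀ vc _ (reverse-bits (bin-bits c)) ⟩
  separator inC (canonical (status none vc)) (reverse vc ++ V₀) (vb ++ sep ∷ va)
    ≡⟨ cong (λ ok → separator inC ok (reverse vc ++ V₀) (vb ++ sep ∷ va)) (bin-canonical c) ⟩
  process inB none V₁ (vb ++ sep ∷ va)
    ≡⟨ process-bits inB none V₁ vb _ (reverse-bits (bin-bits b)) ⟩
  separator inB (canonical (status none vb)) (reverse vb ++ V₁) va
    ≡⟨ cong (λ ok → separator inB ok (reverse vb ++ V₁) va) (bin-canonical b) ⟩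
  process inA none V₂ va
    ≡⟨ cong (process inA none V₂) (++-identityʳ va) ⟨
  process inA none V₂ (va ++ [])
    ≡⟨ process-bits inA none V₂ va [] (reverse-bits (bin-bits a)) ⟩
  accept inA (canonical (status none va)) (reverse va ++ V₂)
    ≡⟨ cong (λ ok → accept inA ok (reverse va ++ V₂)) (bin-canonical a) ⟩
  just (Vec.toList prefix ++ (reverse va ++ V₂))
    ≡⟨ cong just (cong₂ (λ x y → Vec.toList prefix ++ (x ++ sep ∷ b1 ∷ sep ∷ y))
         (reverse-involutive (bin a))
         (cong₂ (λ x y → x ++ sep ∷ b0 ∷ sep ∷ (y ++ V₀))
           (reverse-involutive (bin b)) (reverse-involutive (bin c)))) ⟩
  just (answer a b c) ∎
  where
  open ≡-Reasoning
  va = reverse (bin a)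
  vb = reverse (bin b)
  vc = reverse (bin c)
  V₀ = sep ∷ []
  V₁ = sep ∷ b0 ∷ sep ∷ (reverse vc ++ V₀)
  V₂ = sep ∷ b1 ∷ sep ∷ (reverse vb ++ V₁)

separator-just : ∀ p st V v u {o} → All Bit v → process p st V (v ++ sep ∷ u) ≡ just o →
                 separator p (canonical (status st v)) (reverse v ++ V) u ≡ just o
separator-just p st V v u bits e = trans (≡.sym (process-bits p st V v (sep ∷ u) bits)) e

accept-just : ∀ p st V v {o} → All Bit v → process p st V v ≡ just o →
              accept p (canonical (status st v)) (reverse v ++ V) ≡ just o
accept-just p st V v bits e = trans (≡.sym (process-bits p st V v [] bits))
  (trans (cong (process p st V) (++-identityʳ v)) e)

-- No phase follows `inA`: a separator met here gives `nothing`, so all that is left must be one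
-- numeral.
processA-just : ∀ {V o} u → process inA none V u ≡ just o → ∃[ a ] u ≡ reverse (bin a)
processA-just u e with split-sep u
processA-just u e | v , bits , inj₁ refl with canonical (status none v) in ok | accept-just inA none _ v bits e
... | true | _ = value v , reverse-bin-value v bits ok
processA-just u e | v , bits , inj₂ (u′ , refl)
  with canonical (status none v) | separator-just inA none _ v u′ bits e
... | true  | ()
... | false | ()

processB-just : ∀ {V o} u → process inB none V u ≡ just o →
                ∃[ a ] ∃[ b ] u ≡ reverse (bin b) ++ sep ∷ reverse (bin a)
processB-just u e with split-sep u
processB-just u e | v , bits , inj₁ refl with canonical (status none v) | accept-just inB none _ v bits e
... | true  | ()
... | false | ()
processB-just u e | v , bits , inj₂ (u′ , refl)
  with canonical (status none v) in ok | separator-just inB none _ v u′ bits e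
... | true | e′ with a , refl ← processA-just u′ e′ = a , value v ,
  cong (_++ _) (reverse-bin-value v bits ok)

processC-just : ∀ {V o} u → process inC none V u ≡ just o →
                ∃[ a ] ∃[ b ] ∃[ c ] u ≡ reverse (bin c) ++ sep ∷ (reverse (bin b) ++ sep ∷ reverse (bin a))
processC-just u e with split-sep u
processC-just u e | v , bits , inj₁ refl with canonical (status none v) | accept-just inC none _ v bits e
... | true  | ()
... | false | ()
processC-just u e | v , bits , inj₂ (u′ , refl)
  with canonical (status none v) in ok | separator-just inC none _ v u′ bits e
... | true | e′ with a , b , refl ← processB-just u′ e′ = a , b , value v ,
  cong (_++ _) (reverse-bin-value v bits ok)

translate-just : ∀ w {o} → translate w ≡ just o → ∃[ a ] ∃[ b ] ∃[ c ] w ≡ query a b c × o ≡ answer a b c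
translate-just w e with a , b , c , p ← processC-just (reverse w) e
  with refl ← reverse-injective {x = w} {y = query a b c} (trans p (≡.sym (reverse-query a b c))) =
  a , b , c , refl , just-injective (trans (≡.sym e) (translate-query a b c))

-- Numbering of the machine states

-- A left inverse is what carries a transition function on `A` over to the numbers.
record Code (A : Set) : Set where
  field
    size    : ℕ
    to      : A → Fin size
    from    : Fin size → A
    from-to : ∀ x → from (to x) ≡ x
open Code

finCode : ∀ k → Code (Fin k)
finCode k = record { size = k ; to = id ; from = id ; from-to = λ _ → refl }

via : ∀ {A X : Set} (f : A → X) (g : X → A) → (∀ x → g (f x) ≡ x) → Code X → Code A
via f g gf c = record
  { size = size c ; to = to c ∘ f ; from = g ∘ from c
  ; from-to = λ x → trans (cong g (from-to c (f x))) (gf x) }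

_⊎ᶜ_ : ∀ {A X : Set} → Code A → Code X → Code (A ⊎ X)
c ⊎ᶜ d = record
  { size    = size c + size d
  ; to      = join (size c) (size d) ∘ Sum.map (to c) (to d)
  ; from    = Sum.map (from c) (from d) ∘ splitAt (size c)
  ; from-to = λ where
      (inj₁ x) → trans (cong (Sum.map _ _) (Fin.splitAt-↑ˡ (size c) (to c x) (size d))) (cong inj₁ (from-to c x))
      (inj₂ y) → trans (cong (Sum.map _ _) (Fin.splitAt-↑ʳ (size c) (size d) (to d y))) (cong inj₂ (from-to d y))
  }

_×ᶜ_ : ∀ {A X : Set} → Code A → Code X → Code (A × X)
c ×ᶜ d = record
  { size    = size c * size d
  ; to      = λ (x , y) → combine (to c x) (to d y)
  ; from    = Product.map (from c) (from d) ∘ remQuot (size d)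
  ; from-to = λ (x , y) → trans (cong (Product.map (from c) (from d)) (Fin.remQuot-combine (to c x) (to d y)))
                                (cong₂ _,_ (from-to c x) (from-to d y))
  }

vecCode : ∀ {A : Set} → Code A → ∀ k → Code (Vec A k)
vecCode c zero    = via (λ _ → zero) (λ _ → []) (λ { [] → refl }) (finCode 1)
vecCode c (suc k) = via (λ v → Vec.head v , Vec.tail v) (λ (x , v) → x ∷ v) (λ { (x ∷ v) → refl })
                        (c ×ᶜ vecCode c k)

symCode : Code Sym
symCode = via (λ { b0 → zero ; b1 → suc zero ; sep → suc (suc zero) })
  (Vec.lookup (b0 ∷ b1 ∷ sep ∷ [])) (λ { b0 → refl ; b1 → refl ; sep → refl }) (finCode 3)

statusCode : Code Status
statusCode = via
  (λ { none → zero ; only0 → suc zero ; lead1 → suc (suc zero) ; lead0 → suc (suc (suc zero)) })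
  (Vec.lookup (none ∷ only0 ∷ lead1 ∷ lead0 ∷ []))
  (λ { none → refl ; only0 → refl ; lead1 → refl ; lead0 → refl }) (finCode 4)

-- The machine

-- The number of cells by which this part of the input has to move to the left.
shift : Phase → ℕ
shift inC = 0
shift inB = 2
shift inA = 4

-- The head first runs to the right end of the input. On the way back it keeps
-- in the state those symbols that are due to be written but whose cells still
-- hold unread input, leftmost first. Finally flush buf k writes the first k + 1
-- symbols of prefix ++ buf from right to left.
data State : Set where
  scan  : State
  halt  : State
  read  : ∀ p → Status → Vec Sym (shift p) → State
  flush : Vec Sym 4 → Fin 19 → State

record Numbering : Set where
  field
    q        : ℕ
    to       : State → Fin (suc q)
    from     : Fin (suc q) → State
    from-to  : ∀ s → from (to s) ≡ s
    to-scan  : to scan ≡ zero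

-- opaque, since the numbers of the states are expensive to evaluate.
opaque
  numbering : Numbering
  numbering = record
    { q       = size code
    ; to      = λ s → toFin (f s)
    ; from    = λ i → g (fromFin i)
    ; from-to = λ s → trans (cong g (fromFin-toFin (f s))) (gf s)
    ; to-scan = refl
    }
    where
    Raw : Set
    Raw = Fin 1 ⊎ (Status × Vec Sym 0) ⊎ (Status × Vec Sym 2) ⊎ (Status × Vec Sym 4) ⊎ (Vec Sym 4 × Fin 19)

    readCode : ∀ k → Code (Status × Vec Sym k)
    readCode k = statusCode ×ᶜ vecCode symCode k

    code : Code Raw
    code = finCode 1 ⊎ᶜ (readCode 0 ⊎ᶜ (readCode 2 ⊎ᶜ (readCode 4 ⊎ᶜ (vecCode symCode 4 ×ᶜ finCode 19))))

    toFin : Maybe Raw → Fin (suc (size code))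
    -- `scan` is the start state and must receive the number zero, hence the extra point in front of
    -- the code.
    toFin nothing  = zero
    toFin (just x) = suc (to code x)

    fromFin : Fin (suc (size code)) → Maybe Raw
    fromFin zero    = nothing
    fromFin (suc i) = just (from code i)

    fromFin-toFin : ∀ x → fromFin (toFin x) ≡ x
    fromFin-toFin nothing  = refl
    fromFin-toFin (just x) = cong just (from-to code x)

    f : State → Maybe Raw
    f scan              = nothing
    f halt              = just (inj₁ zero)
    f (read inC st buf) = just (inj₂ (inj₁ (st , buf)))
    f (read inB st buf) = just (inj₂ (inj₂ (inj₁ (st , buf))))
    f (read inA st buf) = just (inj₂ (inj₂ (inj₂ (inj₁ (st , buf)))))
    f (flush buf k)     = just (inj₂ (inj₂ (inj₂ (inj₂ (buf , k)))))

    g : Maybe Raw → State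
    g nothing                                          = scan
    g (just (inj₁ _))                                  = halt
    g (just (inj₂ (inj₁ (st , buf))))                  = read inC st buf
    g (just (inj₂ (inj₂ (inj₁ (st , buf)))))           = read inB st buf
    g (just (inj₂ (inj₂ (inj₂ (inj₁ (st , buf))))))    = read inA st buf
    g (just (inj₂ (inj₂ (inj₂ (inj₂ (buf , k))))))     = flush buf k

    gf : ∀ s → g (f s) ≡ s
    gf scan              = refl
    gf halt              = refl
    gf (read inC st buf) = refl
    gf (read inB st buf) = refl
    gf (read inA st buf) = refl
    gf (flush buf k)     = refl

module N = Numbering numbering

unsnoc : ∀ {k} → Vec Sym (suc k) → Vec Sym k × Sym
unsnoc (x ∷ [])    = [] , x
unsnoc (x ∷ y ∷ v) = Product.map₁ (x ∷_) (unsnoc (y ∷ v))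

unsnoc-++ : ∀ {k} (v : Vec Sym (suc k)) r →
            Vec.toList (proj₁ (unsnoc v)) ++ proj₂ (unsnoc v) ∷ r ≡ Vec.toList v ++ r
unsnoc-++ (x ∷ [])    r = refl
unsnoc-++ (x ∷ y ∷ v) r = cong (x ∷_) (unsnoc-++ (y ∷ v) r)

Action : Set
Action = State × Sym × Move

-- The buffer is a queue: what was read has entered on the left, and the rightmost symbol goes into
-- the cell under the head.
shiftOut : ∀ p → Status → Vec Sym (suc (shift p)) → Action
shiftOut p st v = read p st (proj₁ (unsnoc v)) , proj₂ (unsnoc v) , L

reject : Action
reject = halt , sep , S

-- One separator is expanded to three symbols, and one of the waiting symbols is written into its
-- cell, so the buffer grows by two.
onSep : ∀ p → Bool → Vec Sym (shift p) → Action
onSep inC true buf = shiftOut inB none (sep ∷ b0 ∷ sep ∷ buf)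
onSep inB true buf = shiftOut inA none (sep ∷ b1 ∷ sep ∷ buf)
onSep _   _    buf = reject

onBlank : ∀ p → Bool → Vec Sym (shift p) → Action
-- The 15 + 4 symbols still to be written have last index 18. The `b0` is a placeholder, overwritten
-- by the first flushing step in the same cell.
onBlank inA true buf = flush buf (fromℕ 18) , b0 , S
onBlank _   _    buf = reject

flushStep : Vec Sym 4 → Fin 19 → Action
flushStep buf zero    = halt , Vec.lookup (prefix Vec.++ buf) zero , S
flushStep buf (suc k) = flush buf (inject₁ k) , Vec.lookup (prefix Vec.++ buf) (suc k) , L

transition : State → Maybe Sym → Maybe Action
transition scan            (just s)   = just (scan , s , R)
transition scan            nothing    = just (read inC none [] , sep , L)
transition halt            _          = nothing
transition (read p st buf) (just b0)  = just (shiftOut p (next st b0) (b0 ∷ buf))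
transition (read p st buf) (just b1)  = just (shiftOut p (next st b1) (b1 ∷ buf))
transition (read p st buf) (just sep) = just (onSep p (canonical st) buf)
transition (read p st buf) nothing    = just (onBlank p (canonical st) buf)
transition (flush buf k)   _          = just (flushStep buf k)

letter : Sym → Fin 4
letter b0  = suc zero
letter b1  = suc (suc zero)
letter sep = suc (suc (suc zero))

symbol : Fin 4 → Maybe Sym
symbol = Vec.lookup (nothing ∷ just b0 ∷ just b1 ∷ just sep ∷ [])

machine : TM
machine = record
  { q = N.q
  ; γ = 0
  ; δ = λ i x → Maybe.map (λ (s , o , d) → N.to s , letter o , d)
                          (transition (N.from i) (symbol x))
  }

-- Correctness and running time of the machine

letter-enc : ∀ s → letter s ≡ enc machine s
letter-enc b0  = refl
letter-enc b1  = refl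
letter-enc sep = refl

tape : Word → List (Fin 4)
tape = map (enc machine)

cell : Maybe Sym → Fin 4
cell (just s) = enc machine s
cell nothing  = zero

symbol-cell : ∀ x → symbol (cell x) ≡ x
symbol-cell nothing    = refl
symbol-cell (just b0)  = refl
symbol-cell (just b1)  = refl
symbol-cell (just sep) = refl

readOut-tape : ∀ w → readOut machine (tape w) ≡ w
readOut-tape []        = refl
readOut-tape (b0 ∷ w)  = cong (b0 ∷_) (readOut-tape w)
readOut-tape (b1 ∷ w)  = cong (b1 ∷_) (readOut-tape w)
readOut-tape (sep ∷ w) = cong (sep ∷_) (readOut-tape w)

δ-transition : ∀ s x {s′ o d} → transition s x ≡ just (s′ , o , d) →
               TM.δ machine (N.to s) (cell x) ≡ just (N.to s′ , enc machine o , d)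
δ-transition s x {s′} {o} e
  rewrite N.from-to s | symbol-cell x | e | letter-enc o = refl

run-halt : ∀ l h r → run machine 0 (cfg (N.to halt) l h r) ≡ just (cfg (N.to halt) l h r)
run-halt l h r rewrite N.from-to halt = refl

run-step : ∀ {st h st′ h′ d c} t l r → TM.δ machine st h ≡ just (st′ , h′ , d) →
           run machine t (move machine d st′ l h′ r) ≡ just c → run machine (suc t) (cfg st l h r) ≡ just c
run-step t l r e p rewrite e = p

run-mono : ∀ {t t′} k {c} → t ≤ t′ → run machine t k ≡ just c → run machine t′ k ≡ just c
run-mono                  (cfg st l h r) t≤t′       p with TM.δ machine st h
run-mono {zero}  {zero}   (cfg st l h r) t≤t′       p | nothing = p
run-mono {zero}  {suc t′} (cfg st l h r) t≤t′       p | nothing = p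
run-mono {suc t} {suc t′} (cfg st l h r) t≤t′       p | nothing = p
run-mono {suc t} {suc t′} (cfg st l h r) (s≤s t≤t′) p | just (st′ , h′ , d) =
  run-mono (move machine d st′ l h′ r) t≤t′ p

-- The time is only bounded, so that an early rejection and a full run fit the same statement.
record Outcome (bound : ℕ) (k : Config machine) (P : Word → Set) : Set where
  constructor outcome
  field
    {time}  : ℕ
    {final} : Config machine
    in-time : time ≤ bound
    runs    : run machine time k ≡ just final
    holds   : P (output machine final)

outcome-step : ∀ s x {s′ o d k t P} l r → transition s x ≡ just (s′ , o , d) →
               k ≡ move machine d (N.to s′) l (enc machine o) r →
               Outcome t k P → Outcome (suc t) (cfg (N.to s) l (cell x) r) P
outcome-step s x l r e refl (outcome {t} b p q) =
  outcome (s≤s b) (run-step t l r (δ-transition s x e) p) q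

-- The head stands on the first symbol of the reversed word u, r lies to its right.
leftward : State → Word → Word → Config machine
leftward s u r = cfg (N.to s) (tape (drop 1 u)) (cell (head u)) (tape r)

step-L : ∀ {s s′ o t P} u r → transition s (head u) ≡ just (s′ , o , L) →
         Outcome t (leftward s′ (drop 1 u) (o ∷ r)) P → Outcome (suc t) (leftward s u r) P
step-L {s} {s′} {o} u r e = outcome-step s (head u) (tape (drop 1 u)) (tape r) e (moved (drop 1 u))
  where
  moved : ∀ u → leftward s′ u (o ∷ r) ≡ move machine L (N.to s′) (tape u) (enc machine o) (tape r)
  moved []      = refl
  moved (x ∷ u) = refl

step-S : ∀ {s s′ o t P} u r → transition s (head u) ≡ just (s′ , o , S) →
         Outcome t (leftward s′ (o ∷ drop 1 u) r) P → Outcome (suc t) (leftward s u r) P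
step-S {s} u r e = outcome-step s (head u) (tape (drop 1 u)) (tape r) e refl

step-halt : ∀ {s o t P} u r → transition s (head u) ≡ just (halt , o , S) → P (o ∷ r) →
            Outcome (suc t) (leftward s u r) P
step-halt {o = o} {P = P} u r e p = step-S u r e
  (outcome z≤n (run-halt _ (enc machine o) (tape r)) (subst P (≡.sym (readOut-tape (o ∷ r))) p))

firsts : ∀ {A : Set} {k} → Vec A k → Fin k → List A
firsts (x ∷ v) zero    = x ∷ []
firsts (x ∷ v) (suc i) = x ∷ firsts v i

firsts-fromℕ : ∀ {A : Set} {k} (v : Vec A (suc k)) → firsts v (fromℕ k) ≡ Vec.toList v
firsts-fromℕ (x ∷ [])    = refl
firsts-fromℕ (x ∷ y ∷ v) = cong (x ∷_) (firsts-fromℕ (y ∷ v))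

firsts-suc : ∀ {A : Set} {k} (v : Vec A (suc k)) i r →
             firsts v (inject₁ i) ++ Vec.lookup v (suc i) ∷ r ≡ firsts v (suc i) ++ r
firsts-suc (x ∷ y ∷ v) zero    r = refl
firsts-suc (x ∷ y ∷ v) (suc i) r = cong (x ∷_) (firsts-suc (y ∷ v) i r)

-- The condition on `u` says that only blanks lie to the left of the head. The recursion is on `j`,
-- as `inject₁ k` is not structurally smaller than `suc k`.
flush-outcome : ∀ buf k j → toℕ k ≡ j → ∀ u r → drop 1 u ≡ [] →
                Outcome (suc j) (leftward (flush buf k) u r) (_≡ firsts (prefix Vec.++ buf) k ++ r)
flush-outcome buf zero    j       _ u r _  = step-halt u r refl refl
flush-outcome buf (suc k) (suc j) e u r u₁ = step-L u r refl
  (subst₂ (λ u w → Outcome (suc j) (leftward (flush buf (inject₁ k)) u (o ∷ r)) (_≡ w))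
    (≡.sym u₁) (firsts-suc (prefix Vec.++ buf) k r)
    (flush-outcome buf (inject₁ k) j (trans (Fin.toℕ-inject₁ k) (suc-injective e)) [] (o ∷ r) refl))
  where o = Vec.lookup (prefix Vec.++ buf) (suc k)

-- On malformed input the machine leaves a word starting with a separator.
Answers : Maybe Word → Word → Set
Answers (just w) o = o ≡ w
Answers nothing  o = ∃[ w ] o ≡ sep ∷ w

-- The invariant of the way back: the buffer followed by the tape to the right is the known part of
-- the answer. Each symbol takes one step; of the final 20, one is for the blank and 19 are for
-- `prefix` and the buffer.
read-outcome : ∀ u p st buf r → Outcome (length u + 20) (leftward (read p st buf) u r)
                                        (Answers (process p st (Vec.toList buf ++ r) u))

shiftOut-outcome : ∀ {s} x u p st v r → transition s (just x) ≡ just (shiftOut p st v) →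
                   Outcome (suc (length u + 20)) (leftward s (x ∷ u) r)
                           (Answers (process p st (Vec.toList v ++ r) u))
shiftOut-outcome x u p st v r e = step-L (x ∷ u) r e
  (subst (λ V → Outcome _ (leftward (read p st buf) u (o ∷ r)) (Answers (process p st V u)))
    (unsnoc-++ v r) (read-outcome u p st buf (o ∷ r)))
  where
  buf = proj₁ (unsnoc v)
  o   = proj₂ (unsnoc v)

onSep-outcome : ∀ {s} p ok buf u r → transition s (just sep) ≡ just (onSep p ok buf) →
                Outcome (suc (length u + 20)) (leftward s (sep ∷ u) r)
                        (Answers (separator p ok (Vec.toList buf ++ r) u))
onSep-outcome inC true  buf u r e = shiftOut-outcome sep u inB none (sep ∷ b0 ∷ sep ∷ buf) r e
onSep-outcome inB true  buf u r e = shiftOut-outcome sep u inA none (sep ∷ b1 ∷ sep ∷ buf) r e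
onSep-outcome inA true  buf u r e = step-halt (sep ∷ u) r e (r , refl)
onSep-outcome inC false buf u r e = step-halt (sep ∷ u) r e (r , refl)
onSep-outcome inB false buf u r e = step-halt (sep ∷ u) r e (r , refl)
onSep-outcome inA false buf u r e = step-halt (sep ∷ u) r e (r , refl)

onBlank-outcome : ∀ {s} p ok buf r → transition s nothing ≡ just (onBlank p ok buf) →
                  Outcome 20 (leftward s [] r) (Answers (accept p ok (Vec.toList buf ++ r)))
onBlank-outcome inC ok    buf r e = step-halt [] r e (r , refl)
onBlank-outcome inB ok    buf r e = step-halt [] r e (r , refl)
onBlank-outcome inA false buf r e = step-halt [] r e (r , refl)
onBlank-outcome inA true  buf r e = step-S [] r e
  (subst (λ o → Outcome 19 (leftward (flush buf (fromℕ 18)) (b0 ∷ []) r) (_≡ o)) flushed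
    (flush-outcome buf (fromℕ 18) 18 refl (b0 ∷ []) r refl))
  where
  flushed : firsts (prefix Vec.++ buf) (fromℕ 18) ++ r ≡ Vec.toList prefix ++ (Vec.toList buf ++ r)
  flushed = trans (cong (_++ r) (trans (firsts-fromℕ (prefix Vec.++ buf)) (Vec.toList-++ prefix buf)))
                  (++-assoc (Vec.toList prefix) (Vec.toList buf) r)

read-outcome []        p st buf r = onBlank-outcome p (canonical st) buf r refl
read-outcome (b0 ∷ u)  p st buf r = shiftOut-outcome b0 u p (next st b0) (b0 ∷ buf) r refl
read-outcome (b1 ∷ u)  p st buf r = shiftOut-outcome b1 u p (next st b1) (b1 ∷ buf) r refl
read-outcome (sep ∷ u) p st buf r = onSep-outcome p (canonical st) buf u r refl

scanning : Word → Word → Config machine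
scanning l u = cfg (N.to scan) (tape l) (cell (head u)) (tape (drop 1 u))

scan-outcome : ∀ {t P} u l → Outcome t (leftward (read inC none []) (reverse u ++ l) (sep ∷ [])) P →
               Outcome (suc (length u + t)) (scanning l u) P
scan-outcome []      l = outcome-step scan nothing (tape l) [] refl (moved l)
  where
  moved : ∀ l → leftward (read inC none []) l (sep ∷ []) ≡
                move machine L (N.to (read inC none [])) (tape l) (enc machine sep) []
  moved []      = refl
  moved (x ∷ l) = refl
scan-outcome {t} {P} (x ∷ u) l out = outcome-step scan (just x) (tape l) (tape u) refl (moved u)
  (scan-outcome u (x ∷ l) (subst (λ w → Outcome t (leftward (read inC none []) w (sep ∷ [])) P)
    (trans (cong (_++ l) (unfold-reverse x u)) (++-assoc (reverse u) (x ∷ []) l)) out))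
  where
  moved : ∀ u → scanning (x ∷ l) u ≡ move machine R (N.to scan) (tape l) (enc machine x) (tape u)
  moved []      = refl
  moved (y ∷ u) = refl

initial-scanning : ∀ w → initial machine w ≡ scanning [] w
initial-scanning []      = cong (λ i → cfg i [] zero []) (≡.sym N.to-scan)
initial-scanning (x ∷ w) = cong (λ i → cfg i [] (enc machine x) (tape w)) (≡.sym N.to-scan)

machine-outcome : ∀ w → Outcome (suc (length w + (length w + 20))) (initial machine w) (Answers (translate w))
machine-outcome w rewrite initial-scanning w = scan-outcome w []
  (subst₂ (λ k u → Outcome (k + 20) (leftward (read inC none []) u (sep ∷ [])) (Answers (translate w)))
    (length-reverse w) (≡.sym (++-identityʳ (reverse w)))
    (read-outcome (reverse w) inC none [] (sep ∷ [])))

machine-time : ∀ k → suc (k + (k + 20)) ≤ 21 * suc k ^ 1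
machine-time k = begin
  suc (k + (k + 20))      ≡⟨ solve 1 (λ k → con 1 :+ (k :+ (k :+ con 20)) := con 2 :* k :+ con 21) refl k ⟩
  2 * k + 21              ≤⟨ +-monoˡ-≤ 21 (*-monoˡ-≤ k {2} {21} (s≤s (s≤s z≤n))) ⟩
  21 * k + 21             ≡⟨ solve 1 (λ k → con 21 :* k :+ con 21 := con 21 :* ((con 1 :+ k) :* con 1)) refl k ⟩
  21 * (suc k * 1)        ∎
  where
  open ≤-Reasoning
  open +-*-Solver using (solve; con; _:+_; _:*_; _:=_)

machine-halts : ∀ w → ∃[ o ] HaltsWith machine w (21 * suc (length w) ^ 1) o × Answers (translate w) o
machine-halts w with outcome {final = c} b p q ← machine-outcome w =
  output machine c , (c , run-mono (initial machine w) (≤-trans b (machine-time (length w))) p , refl) , q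

-- The reduction

-- `Fᶜ` and `Fᵇ` come first so that the indices inserted between the input numbers are the single
-- digits 0 and 1.
𝓖 : List Graph
𝓖 = ⟦ Fᶜ ⟧ ∷ ⟦ Fᵇ ⟧ ∷ ⟦ Fᵃ ⟧ ∷ ⟦ C ⟧ ∷ ⟦ D ⟧ ∷ []

pairs : ℕ → ℕ → ℕ → List (Fin 5 × ℕ)
pairs a b c = (# 3 , 1) ∷ (# 4 , 2) ∷ (# 2 , a) ∷ (# 1 , b) ∷ (# 0 , c) ∷ []

Realisable : List (Fin 5 × ℕ) → Set
Realisable ps = Σ Graph λ G → All (λ (i , h) → hom (lookup 𝓖 i) G ≡ h) ps

Solvable : ℕ → ℕ → ℕ → Set
Solvable a b c = ∃[ x ] ∃[ y ] a * (x * x) + b * y ≡ c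

solvable⇒realisable : ∀ a b c → Solvable a b c → Realisable (pairs a b c)
solvable⇒realisable a b c (x , y , e) = G , hom-C ∷ hom-D ∷ hom-Fᵃ ∷ hom-Fᵇ ∷ trans hom-Fᶜ e ∷ []
  where open Solution⇒Graph a b x y

realisable⇒solvable : ∀ a b c → Realisable (pairs a b c) → Solvable a b c
realisable⇒solvable a b c (G , hom-C ∷ hom-D ∷ hom-Fᵃ ∷ hom-Fᵇ ∷ hom-Fᶜ ∷ []) =
  Graph⇒Solution.solution G hom-C hom-D hom-Fᵃ hom-Fᵇ hom-Fᶜ

QPoly⇒solvable : ∀ a b c → QPoly (query a b c) → Solvable a b c
QPoly⇒solvable a b c (a′ , b′ , c′ , e , solution)
  with refl , refl , refl ← query-injective {a} {b} {c} {a′} {b′} {c′} e = solution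

HomRec⇒realisable : ∀ a b c → HomRec 𝓖 (answer a b c) → Realisable (pairs a b c)
HomRec⇒realisable a b c (ps , e , realisation) =
  subst Realisable (≡.sym (encPairs-injective (pairs a b c) ps e)) realisation

reduces : ∀ w o → Answers (translate w) o → (QPoly w → HomRec 𝓖 o) × (HomRec 𝓖 o → QPoly w)
reduces w o answers with translate w in e
reduces w o (_ , refl) | nothing =
  -- A rejected `w` is no query, and `o` starts with a separator, so neither side holds.
  (λ { (a , b , c , refl , _) → contradiction (trans (≡.sym e) (translate-query a b c)) λ () }) ,
  (λ { (ps , q , _) → contradiction (≡.sym q) (encPairs-head ps) })
reduces w o refl | just _ with a , b , c , refl , refl ← translate-just w e =
  (λ q → pairs a b c , refl , solvable⇒realisable a b c (QPoly⇒solvable a b c q)) ,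
  (λ r → a , b , c , refl , realisable⇒solvable a b c (HomRec⇒realisable a b c r))

theorem15 : Σ (List Graph) λ 𝓕 → QPoly ≤p HomRec 𝓕
theorem15 = 𝓖 , machine , 21 , 1 , λ w →
  let o , halts , answers = machine-halts w in o , halts , reduces w o answers
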